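{- For every real number $c<4$ there exists an integer $n_0$ such that $\text{sat}^*(n, \mathcal D_2)\geq c\sqrt n$ for every $n\geq n_0$.
   Context: All families considered are families of subsets of $[n]=\{1,\dots,n\}$, partially ordered by inclusion. The diamond poset $\mathcal D_2$ is the 4-element poset with one minimal element, one maximal element and two incomparable middle elements (the two-dimensional Boolean lattice). A family $\mathcal F$ contains an induced copy of $\mathcal D_2$ if there are four distinct sets $W,X,Y,Z\in\mathcal F$ with $W\subset X\subset Z$, $W\subset Y\subset Z$ and $X,Y$ incomparable under inclusion. A family $\mathcal F$ of subsets of $[n]$ is $\mathcal D_2$-saturated if it contains no induced copy of $\mathcal D_2$, but for every subset $S\subseteq[n]$ with $S\notin\mathcal F$, the family $\mathcal F\cup\{S\}$ contains an induced copy of $\mathcal D_2$. $\text{sat}^*(n,\mathcal D_2)$ denotes the minimum size of a $\mathcal D_2$-saturated family of subsets of $[n]$. -}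

module Defs where

open import Data.Nat using (ℕ)
import Data.Nat
open import Data.Fin.Subset using (Subset; _⊂_; _⊆_)
open import Data.List using (List; _∷_; length)
open import Data.List.Membership.Propositional using (_∈_)
open import Data.Product using (Σ; _×_; ∃-syntax)
open import Data.Sum using (_⊎_)
open import Data.Rational using (ℚ; _≤_; _*_; 0ℚ; _/_)
open import Data.Integer using (+_)
open import Relation.Nullary using (¬_)
open import Relation.Binary.PropositionalEquality using (_≢_)

-- A family of subsets of [n] is a list of subsets (duplicate-freeness is
-- imposed separately via Unique, so that length = size of the family).
Family : ℕ → Set
Family n = List (Subset n)

Incomparable : ∀ {n} → Subset n → Subset n → Set
Incomparable X Y = ¬ (X ⊆ Y) × ¬ (Y ⊆ X)

HasInducedD2 : ∀ {n} → Family n → Set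
HasInducedD2 {n} F =
  ∃[ W ] ∃[ X ] ∃[ Y ] ∃[ Z ]
    ( W ∈ F × X ∈ F × Y ∈ F × Z ∈ F
    × W ≢ X × W ≢ Y × W ≢ Z × X ≢ Y × X ≢ Z × Y ≢ Z
    × W ⊂ X × X ⊂ Z × W ⊂ Y × Y ⊂ Z
    × Incomparable X Y )

D2Saturated : ∀ {n} → Family n → Set
D2Saturated {n} F =
  ¬ HasInducedD2 F × ((S : Subset n) → ¬ (S ∈ F) → HasInducedD2 (S ∷ F))

ℕtoℚ : ℕ → ℚ
ℕtoℚ m = (+ m) / 1

_*√_≤_ : ℚ → ℕ → ℕ → Set
c *√ n ≤ m = (c ≤ 0ℚ) ⊎ (0ℚ ≤ c × c * c * ℕtoℚ n ≤ ℕtoℚ (m Data.Nat.* m))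

{-# OPTIONS --safe #-}
module Submission where

-- Let N = |F|.  A set S containing no member of F can only enter a diamond as its
-- bottom, so diamond-freeness makes every Q ∈ F stick out of some X ∈ F with S ⊆ X.
-- Hence minimal members of F, and complements of maximal such "free" S, have at most N
-- elements.  If i lies in at most K minimal members and Q ∖ S = {i} with Q minimal,
-- then for any other i′ ∈ Q the set (S ∪ {i}) ∖ {i′} contains at most K − 1 minimal
-- members; deleting from each of them a point outside Q makes it free again, so i′ is
-- missed by some X ∈ F with |S ∖ X| ≤ K.  All such Q therefore lie in a set of N + N K
-- points depending on S only, and counting pairs of labels sharing a Q bounds the
-- union of the minimal members by o(N²).  Complementing, the maximal members miss
-- o(N²) points.  For any remaining i, a maximal P ∈ F avoiding i has P ∪ {i} ∈ F, and
-- there are fewer than N such i: projecting them out one at a time identifies two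
-- members each time. So n = o(N²), and in particular 16 n ≤ N² for large n.

open import Defs
open import Data.Empty using (⊥-elim)
open import Data.Bool.Properties using () renaming (_≟_ to _≟ᵇ_)
open import Data.Fin using (Fin; zero; suc)
open import Data.Fin.Properties using (any?; all?) renaming (_≟_ to _≟ᶠ_)
open import Data.Fin.Subset using (Subset; _∈_; _∉_; _⊆_; _⊈_; _⊂_; _∪_; ⁅_⁆; ∁) renaming (⊥ to ∅)
open import Data.Fin.Subset.Properties using (_∈?_; _⊆?_; anySubset?; ⊆-antisym;
  x∈p∪q⁺; x∈p∪q⁻; x∈⁅x⁆; x∈⁅y⁆⇒x≡y; x∈∁p⇒x∉p; x∉∁p⇒x∈p; x∉p⇒x∈∁p; x∈p⇒x∉∁p; ∁p⊆∁q⇒p⊇q)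
open import Data.Integer using (+_)
import Data.Integer as ℤ
import Data.Integer.Properties as ℤ
open import Data.List using (List; []; _∷_; _++_; length; map; filter; allFin; lookup)
open import Data.List.Membership.Propositional using (find; lose) renaming (_∈_ to _∈ˡ_)
open import Data.List.Membership.Propositional.Properties using (∈-map⁺; ∈-map⁻; ∈-filter⁺;
  ∈-filter⁻; ∈-lookup; ∈-allFin)
open import Data.List.Properties using (length-map; length-++; length-tabulate)
open import Data.List.Relation.Binary.Pointwise using (Pointwise; []; _∷_; Pointwise-length)
open import Data.List.Relation.Unary.All as All using (All; []; _∷_)
import Data.List.Relation.Unary.All.Properties as All
open import Data.List.Relation.Unary.AllPairs using ([]; _∷_)
open import Data.List.Relation.Unary.Any as Any using (Any; here; there)
open import Data.List.Relation.Unary.Unique.Propositional using (Unique)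
import Data.List.Relation.Unary.Unique.Propositional.Properties as Unique
open import Data.Nat using (ℕ; suc; _+_; _*_; z≤n; s≤s; >-nonZero) renaming (_≤_ to _≤ℕ_; _<_ to _<ℕ_; _≤?_ to _≤ℕ?_)
open import Data.Nat.Properties
open import Data.Nat.Tactic.RingSolver using (solve-∀)
open import Data.Product using (_×_; _,_; proj₁; proj₂; ∃-syntax)
open import Data.Product.Properties using (,-injectiveʳ)
open import Data.Rational using (ℚ; _<_; 0ℚ; nonNegative; toℚᵘ) renaming (_≤_ to _≤ℚ_; _*_ to _*ℚ_)
import Data.Rational.Properties as ℚ
open import Data.Rational.Unnormalised using (mkℚᵘ; *≤*; *≡*) renaming (_≃_ to _≃ᵘ_; _*_ to _*ᵘ_)
import Data.Rational.Unnormalised.Properties as ℚᵘ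
open import Data.Sum using (_⊎_; inj₁; inj₂; [_,_]′)
import Data.Vec as Vec
open import Data.Vec.Properties using (lookup⇒[]=; []=⇒lookup; lookup∘tabulate; ≡-dec)
open import Function using (_∘_; id)
import Relation.Binary as B
import Relation.Binary.Reasoning.Setoid as ≈-Reasoning
open import Relation.Binary.PropositionalEquality
open import Relation.Nullary using (¬_; Dec; yes; no; does; contradiction; ¬?)
open import Relation.Nullary.Decidable using (_×-dec_; _⊎-dec_; _→-dec_; decidable-stable; dec-true)
open import Relation.Unary using (Decidable)

-- Counting by bounds on duplicate-free lists.

-- At most m / k elements satisfy P, stated without division.
Bounded : {A : Set} → ℕ → (A → Set) → ℕ → Set
Bounded k P m = ∀ {L} → Unique L → All P L → k * length L ≤ℕ m

module _ {A : Set} where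

  bounded-⇒ : ∀ {k m} {P Q : A → Set} → (∀ {x} → P x → Q x) → Bounded k Q m → Bounded k P m
  bounded-⇒ f b uL pL = b uL (All.map f pL)

  -- The empty list meets every bound, so the bound may be read off from a fact that some listed
  -- element carries.
  bounded-by-member : ∀ {k m} {P : A → Set} → (∀ {x} → P x → Bounded k P m) → Bounded k P m
  bounded-by-member {k} h {[]} uL pL = ≤-trans (≤-reflexive (*-zeroʳ k)) z≤n
  bounded-by-member h {_ ∷ _} uL pL@(px ∷ _) = h px uL pL

  bounded-scale : ∀ {m} {P : A → Set} t → Bounded 1 P m → Bounded t P (t * m)
  bounded-scale t b {L} uL pL = *-monoʳ-≤ t (≤-trans (≤-reflexive (sym (*-identityˡ (length L)))) (b uL pL))

  -- The last component passes the freshness of a head on to both parts, which keeps them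
  -- duplicate-free.
  all-⊎⁻ : ∀ {P Q : A → Set} {L} → Unique L → All (λ x → P x ⊎ Q x) L →
    ∃[ L₁ ] ∃[ L₂ ] (Unique L₁ × Unique L₂ × All P L₁ × All Q L₂ ×
      length L₁ + length L₂ ≡ length L ×
      (∀ {R : A → Set} → All R L → All R L₁ × All R L₂))
  all-⊎⁻ [] [] = [] , [] , [] , [] , [] , [] , refl , λ _ → [] , []
  all-⊎⁻ (x≢ ∷ uL) (inj₁ p ∷ pL) with all-⊎⁻ uL pL
  ... | L₁ , L₂ , u₁ , u₂ , p₁ , p₂ , eq , sub =
    _ , L₂ , proj₁ (sub x≢) ∷ u₁ , u₂ , p ∷ p₁ , p₂ , cong suc eq ,
    λ { (r ∷ rL) → r ∷ proj₁ (sub rL) , proj₂ (sub rL) }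
  all-⊎⁻ (x≢ ∷ uL) (inj₂ q ∷ pL) with all-⊎⁻ uL pL
  ... | L₁ , L₂ , u₁ , u₂ , p₁ , p₂ , eq , sub =
    L₁ , _ , u₁ , proj₂ (sub x≢) ∷ u₂ , p₁ , q ∷ p₂ ,
    trans (+-suc (length L₁) (length L₂)) (cong suc eq) ,
    λ { (r ∷ rL) → proj₁ (sub rL) , r ∷ proj₂ (sub rL) }

  bounded-⊎ : ∀ {k a b} {P Q : A → Set} → Bounded k P a → Bounded k Q b →
    Bounded k (λ x → P x ⊎ Q x) (a + b)
  bounded-⊎ {k} bP bQ uL pL with all-⊎⁻ uL pL
  ... | L₁ , L₂ , u₁ , u₂ , p₁ , p₂ , eq , _ =
    ≤-trans (≤-reflexive (trans (cong (k *_) (sym eq)) (*-distribˡ-+ k (length L₁) (length L₂))))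
      (+-mono-≤ (bP u₁ p₁) (bQ u₂ p₂))

  bounded-≡ : ∀ (y : A) → Bounded 1 (_≡ y) 1
  bounded-≡ y [] [] = z≤n
  bounded-≡ y ([] ∷ []) (_ ∷ []) = s≤s z≤n
  bounded-≡ y ((x≢ ∷ _) ∷ _) (refl ∷ refl ∷ _) = contradiction refl x≢

module _ {A B : Set} where

  -- Injection principle. `R` is a relation because the chosen image of `x` may depend on the proof
  -- of `P x`.
  bounded-via : ∀ {k m} {P : A → Set} {Q : B → Set} (R : A → B → Set) →
    (∀ {x} → P x → ∃[ y ] (Q y × R x y)) →
    (∀ {x x′ y} → R x y → R x′ y → x ≡ x′) →
    Bounded k Q m → Bounded k P m
  bounded-via {k} {P = P} {Q} R f inj b uL pL with image uL pL
    where
    fresh : ∀ {x y L M} → R x y → Pointwise R L M → All (x ≢_) L → All (y ≢_) M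
    fresh r [] [] = []
    fresh r (r′ ∷ rs) (x≢ ∷ xs≢) = (λ { refl → x≢ (inj r r′) }) ∷ fresh r rs xs≢
    image : ∀ {L} → Unique L → All P L → ∃[ M ] (Pointwise R L M × Unique M × All Q M)
    image [] [] = [] , [] , [] , []
    image (x≢ ∷ uL) (p ∷ pL) with f p | image uL pL
    ... | y , q , r | M , rs , uM , qM = y ∷ M , r ∷ rs , fresh r rs x≢ ∷ uM , q ∷ qM
  ... | M , rs , uM , qM = subst (λ l → k * l ≤ℕ _) (sym (Pointwise-length rs)) (b uM qM)

  bounded-⋃ : ∀ {k m} {P : B → A → Set} (ys : List B) →
    (∀ {y} → y ∈ˡ ys → Bounded k (P y) m) →
    Bounded k (λ x → ∃[ y ] (y ∈ˡ ys × P y x)) (length ys * m)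
  bounded-⋃ {k} [] h = bounded-by-member {k = k} λ { (_ , () , _) }
  bounded-⋃ {k} {P = P} (y ∷ ys) h =
    bounded-⇒ {k = k} (λ { (_ , here refl , p) → inj₁ p ; (z , there z∈ , p) → inj₂ (z , z∈ , p) })
      (bounded-⊎ {k = k} (h (here refl)) (bounded-⋃ {k} {P = P} ys (λ y∈ → h (there y∈))))

module _ {A B : Set} where

  bounded-Σ : ∀ {m} {P : B → A → Set} (ys : List B) →
    (∀ {y} → y ∈ˡ ys → Bounded 1 (P y) m) →
    Bounded {A = B × A} 1 (λ (y , x) → y ∈ˡ ys × P y x) (length ys * m)
  bounded-Σ {P = P} ys h = bounded-⇒ {k = 1} (λ {(y , x)} (y∈ , p) → y , y∈ , refl , p)
    (bounded-⋃ {k = 1} {P = λ y′ (y , x) → y ≡ y′ × P y′ x} ys λ {y′} y∈ →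
      bounded-via {k = 1} (λ p x → p ≡ (y′ , x)) (λ { {_ , x} (refl , p) → x , p , refl })
        (λ { refl refl → refl }) (h y∈))

  -- Each listed element contributes at least `t` pairs, and pairs with different first entries
  -- never coincide.
  double-count : ∀ {m} {P : A → Set} t (R : A → B → Set) →
    (∀ {a} → P a → ∃[ bs ] (Unique bs × All (R a) bs × t ≤ℕ length bs)) →
    Bounded {A = A × B} 1 (λ (a , b) → P a × R a b) m → Bounded t P m
  double-count {P = P} t R f b uL pL with pairs uL pL
    where
    pairs : ∀ {L} → Unique L → All P L → ∃[ ps ] (Unique ps ×
      All (λ (a , b) → P a × R a b) ps × All (λ p → proj₁ p ∈ˡ L) ps × t * length L ≤ℕ length ps)
    pairs [] [] = [] , [] , [] , [] , ≤-reflexive (*-zeroʳ t)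
    pairs {a ∷ L} (a≢ ∷ uL) (p ∷ pL) with f p | pairs uL pL
    ... | bs , ubs , rbs , t≤ | ps , ups , qps , ∈L , le =
      map (a ,_) bs ++ ps ,
      Unique.++⁺ (Unique.map⁺ ,-injectiveʳ ubs) ups disj ,
      All.++⁺ (All.map⁺ (All.map (p ,_) rbs)) qps ,
      All.++⁺ (All.map⁺ (All.tabulate {xs = bs} (λ _ → here refl))) (All.map there ∈L) ,
      subst₂ _≤ℕ_ (sym (*-suc t (length L)))
        (sym (trans (length-++ (map (a ,_) bs)) (cong (_+ length ps) (length-map (a ,_) bs))))
        (+-mono-≤ t≤ le)
      where
      disj : ∀ {q} → ¬ (q ∈ˡ map (a ,_) bs × q ∈ˡ ps)
      disj (q∈ , q∈ps) with ∈-map⁻ (a ,_) q∈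
      ... | _ , _ , refl = All.lookup a≢ (All.lookup ∈L q∈ps) refl
  ... | ps , ups , qps , _ , le = ≤-trans le (≤-trans (≤-reflexive (sym (*-identityˡ (length ps)))) (b ups qps))

bounded-∈ : {A : Set} (ys : List A) → Bounded 1 (_∈ˡ ys) (length ys)
bounded-∈ ys = subst (Bounded 1 (_∈ˡ ys)) (*-identityʳ (length ys))
  (bounded-⇒ {k = 1} (λ {x} x∈ → x , x∈ , refl)
    (bounded-⋃ {k = 1} {P = λ y x → x ≡ y} ys (λ {y} _ → bounded-≡ y)))

-- A linear substitute for Cauchy-Schwarz: fibres of size at most `t` hold at most `t` elements per
-- value, while an element of a fibre of size at least `t` takes part in `t` collisions as first
-- entry, so there are at most `m / t` of these.
bounded-collisions : {A B : Set} (_≟_ : B.DecidableEquality B) (q : A → B) (ys : List B)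
  {L : List A} {m : ℕ} →
  Unique L → All (λ a → q a ∈ˡ ys) L →
  Bounded {A = A × A} 1 (λ (a , b) → a ∈ˡ L × b ∈ˡ L × q a ≡ q b) m →
  ∀ t → t * length L ≤ℕ t * (length ys * t) + m
bounded-collisions {A} {B} _≟_ q ys {L} {m} uL q∈ b t =
  bounded-⊎ {k = t} light heavy uL (All.tabulate split)
  where
  fibre : B → List A
  fibre y = filter (λ a → q a ≟ y) L
  Light Heavy : A → Set
  Light a = a ∈ˡ L × length (fibre (q a)) ≤ℕ t
  Heavy a = a ∈ˡ L × t ≤ℕ length (fibre (q a))
  split : ∀ {a} → a ∈ˡ L → Light a ⊎ Heavy a
  split {a} a∈ with ≤-total (length (fibre (q a))) t
  ... | inj₁ le = inj₁ (a∈ , le)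
  ... | inj₂ ge = inj₂ (a∈ , ge)
  light : Bounded t Light (t * (length ys * t))
  light = bounded-scale t (bounded-⇒ {k = 1}
    (λ {a} (a∈ , le) → q a , All.lookup q∈ a∈ , a∈ , refl , le)
    (bounded-⋃ {k = 1} {P = λ y a → a ∈ˡ L × q a ≡ y × length (fibre y) ≤ℕ t} ys λ {y} _ →
      bounded-by-member {k = 1} λ (_ , _ , le) {M} uM pM →
        ≤-trans (bounded-∈ (fibre y) uM (All.map (λ (a∈ , eq , _) → ∈-filter⁺ (λ a → q a ≟ y) a∈ eq) pM)) le))
  heavy : Bounded t Heavy m
  heavy = double-count t (λ a b → b ∈ˡ L × q a ≡ q b)
    (λ {a} (a∈ , ge) → fibre (q a) , Unique.filter⁺ (λ b → q b ≟ q a) uL ,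
      All.tabulate (λ b∈ → let b∈L , e = ∈-filter⁻ (λ b → q b ≟ q a) b∈ in b∈L , sym e) , ge)
    (bounded-⇒ {k = 1} (λ ((a∈ , _) , b∈ , e) → a∈ , b∈ , e) b)

-- Maximal elements of lists, and comprehension of subsets.

module _ {A : Set} {_≼_ : A → A → Set} (≼-refl : B.Reflexive _≼_) (≼-trans : B.Transitive _≼_)
  (_≼?_ : B.Decidable _≼_) where

  -- One pass suffices: a `g` that is not above the current element is not above any larger one
  -- reached later.
  maximal-above : ∀ G {x} → x ∈ˡ G → ∃[ y ] (y ∈ˡ G × x ≼ y × (∀ {z} → z ∈ˡ G → y ≼ z → z ≼ y))
  maximal-above G {x} x∈ with go G x
    where
    go : ∀ G x → ∃[ y ] ((y ≡ x ⊎ y ∈ˡ G) × x ≼ y × (∀ {z} → z ∈ˡ G → y ≼ z → z ≼ y))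
    go [] x = x , inj₁ refl , ≼-refl , λ ()
    go (g ∷ G) x with x ≼? g
    ... | yes x≼g = let y , y∈ , g≼y , max = go G g in
      y , inj₂ ([ here , there ]′ y∈) , ≼-trans x≼g g≼y ,
      λ { (here refl) _ → g≼y ; (there z∈) → max z∈ }
    ... | no x⋠g = let y , y∈ , x≼y , max = go G x in
      y , [ inj₁ , inj₂ ∘ there ]′ y∈ , x≼y ,
      λ { (here refl) y≼g → contradiction (≼-trans x≼y y≼g) x⋠g ; (there z∈) → max z∈ }
  ... | y , inj₁ refl , x≼y , max = y , x∈ , x≼y , max
  ... | y , inj₂ y∈ , x≼y , max = y , y∈ , x≼y , max

lookup-injective : {A : Set} {L : List A} → Unique L → ∀ {a b} → lookup L a ≡ lookup L b → a ≡ b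
lookup-injective (_ ∷ _) {zero} {zero} _ = refl
lookup-injective {L = _ ∷ L} (x≢ ∷ _) {zero} {suc b} e = contradiction e (All.lookup x≢ (∈-lookup b))
lookup-injective {L = _ ∷ L} (x≢ ∷ _) {suc a} {zero} e = contradiction (sym e) (All.lookup x≢ (∈-lookup a))
lookup-injective (_ ∷ u) {suc a} {suc b} e = cong suc (lookup-injective u e)

module _ {n : ℕ} {P : Fin n → Set} (P? : Decidable P) where

  comprehension : Subset n
  comprehension = Vec.tabulate (does ∘ P?)

  ∈-comprehension⁺ : ∀ {i} → P i → i ∈ comprehension
  ∈-comprehension⁺ {i} p = lookup⇒[]= i _ (trans (lookup∘tabulate _ i) (dec-true (P? i) p))

  ∈-comprehension⁻ : ∀ {i} → i ∈ comprehension → P i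
  ∈-comprehension⁻ {i} i∈ with P? i | trans (sym (lookup∘tabulate (does ∘ P?) i)) ([]=⇒lookup i∈)
  ... | yes p | _ = p
  ... | no _ | ()

_≟ˢ_ : ∀ {n} → B.DecidableEquality (Subset n)
_≟ˢ_ = ≡-dec _≟ᵇ_

_∖_≐⁅_⁆ : ∀ {n} → Subset n → Subset n → Fin n → Set
Q ∖ S ≐⁅ i ⁆ = i ∈ Q × i ∉ S × (∀ {j} → j ∈ Q → j ≢ i → j ∈ S)

∖-unique : ∀ {n} {Q S : Subset n} {i j} → Q ∖ S ≐⁅ i ⁆ → j ∈ Q → j ∉ S → j ≡ i
∖-unique {i = i} {j} (_ , _ , rest) j∈ j∉ = decidable-stable (j ≟ᶠ i) λ j≢ → j∉ (rest j∈ j≢)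

module _ {n : ℕ} where

  remove : Fin n → Subset n → Subset n
  remove i Q = comprehension (λ j → (j ∈? Q) ×-dec ¬? (j ≟ᶠ i))

  ∈-remove⁻ : ∀ {i j} Q → j ∈ remove i Q → j ∈ Q × j ≢ i
  ∈-remove⁻ {i} Q = ∈-comprehension⁻ (λ j → (j ∈? Q) ×-dec ¬? (j ≟ᶠ i))

  ∈-remove⁺ : ∀ {i j} Q → j ∈ Q × j ≢ i → j ∈ remove i Q
  ∈-remove⁺ {i} Q = ∈-comprehension⁺ (λ j → (j ∈? Q) ×-dec ¬? (j ≟ᶠ i))

  remove-∖ : ∀ {Q i} → i ∈ Q → Q ∖ remove i Q ≐⁅ i ⁆
  remove-∖ {Q} i∈ = i∈ , (λ i∈′ → proj₂ (∈-remove⁻ Q i∈′) refl) , λ j∈ j≢ → ∈-remove⁺ Q (j∈ , j≢)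

-- Free sets, minimal members and their sizes.

Free : ∀ {n} → List (Subset n) → Subset n → Set
Free F S = All (_⊈ S) F

Minimal : ∀ {n} → List (Subset n) → Subset n → Set
Minimal F Q = All (λ W → W ⊆ Q → Q ⊆ W) F

free? : ∀ {n} (F : List (Subset n)) → Decidable (Free F)
free? F S = All.all? (λ W → ¬? (W ⊆? S)) F

minimal? : ∀ {n} (F : List (Subset n)) → Decidable (Minimal F)
minimal? F Q = All.all? (λ W → (W ⊆? Q) →-dec (Q ⊆? W)) F

-- The form in which saturation enters the counting. It passes to the family of complements, so
-- `Lower` can be applied to both.
Escape : ∀ {n} → List (Subset n) → Set
Escape F = ∀ {S Q} → Free F S → Q ∈ˡ F → ∃[ X ] (X ∈ˡ F × S ⊆ X × ∃[ i ] (i ∈ Q × i ∉ X))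

module Lower {n : ℕ} (F : List (Subset n)) (uF : Unique F) (escape : Escape F) where

  N : ℕ
  N = length F

  minimals : List (Subset n)
  minimals = filter (minimal? F) F

  ∈F : ∀ {Q} → Q ∈ˡ minimals → Q ∈ˡ F
  ∈F = proj₁ ∘ ∈-filter⁻ (minimal? F)

  minimal : ∀ {Q} → Q ∈ˡ minimals → Minimal F Q
  minimal = proj₂ ∘ ∈-filter⁻ (minimal? F) {xs = F}

  minimal-below : ∀ {W} → W ∈ˡ F → ∃[ Q ] (Q ∈ˡ minimals × Q ⊆ W)
  minimal-below W∈
    with Q , Q∈ , Q⊆W , min ← maximal-above {_≼_ = λ X Y → Y ⊆ X} id (λ p q i∈ → p (q i∈))
           (λ X Y → Y ⊆? X) F W∈
    = Q , ∈-filter⁺ (minimal? F) Q∈ (All.tabulate (λ z∈ → min z∈)) , Q⊆W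

  free : ∀ {S} → (∀ {Q} → Q ∈ˡ minimals → Q ⊈ S) → Free F S
  free h = All.tabulate λ W∈ W⊆S →
    let _ , Q∈ , Q⊆W = minimal-below W∈ in h Q∈ (λ i∈ → W⊆S (Q⊆W i∈))

  -- The point of `Q` that `X` misses lies outside `S`, and `i` is the only such point.
  escape-at : ∀ {S Q i} → Free F S → Q ∈ˡ F → Q ∖ S ≐⁅ i ⁆ →
    ∃[ X ] (X ∈ˡ F × S ⊆ X × Q ∖ X ≐⁅ i ⁆)
  escape-at fS Q∈ d@(i∈ , _ , rest) with escape fS Q∈
  ... | X , X∈ , S⊆X , j , j∈ , j∉ with ∖-unique d j∈ (λ j∈S → j∉ (S⊆X j∈S))
  ... | refl = X , X∈ , S⊆X , i∈ , j∉ , λ j∈ j≢ → S⊆X (rest j∈ j≢)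

  -- A member inside `Q` without `i` would, by minimality, contain `Q` and hence `i`.
  remove-free : ∀ {Q i} → Q ∈ˡ minimals → i ∈ Q → Free F (remove i Q)
  remove-free {Q} {i} Q∈ i∈ = All.tabulate λ W∈ W⊆ →
    proj₂ (∈-remove⁻ Q (W⊆ (All.lookup (minimal Q∈) W∈ (λ j∈ → proj₁ (∈-remove⁻ Q (W⊆ j∈))) i∈))) refl

  -- Each `i` in `Q` is the only point of `Q` missed by some member `X`, and `X` determines `i`.
  minimal-size : ∀ {Q} → Q ∈ˡ minimals → Bounded 1 (_∈ Q) N
  minimal-size {Q} Q∈ = bounded-via {k = 1} (λ i X → Q ∖ X ≐⁅ i ⁆)
    (λ i∈ → let X , X∈ , _ , d = escape-at (remove-free Q∈ i∈) (∈F Q∈) (remove-∖ i∈) in X , X∈ , d)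
    (λ (i∈ , i∉ , _) d → ∖-unique d i∈ i∉)
    (bounded-∈ F)

  MaximalFree : Subset n → Set
  MaximalFree S = Free F S × (∀ i → i ∉ S → ¬ Free F (S ∪ ⁅ i ⁆))

  maximalFree? : Decidable MaximalFree
  maximalFree? S = free? F S ×-dec all? (λ i → ¬? (i ∈? S) →-dec ¬? (free? F (S ∪ ⁅ i ⁆)))

  free-⊆ : ∀ {S T} → S ⊆ T → Free F T → Free F S
  free-⊆ S⊆T = All.map λ W⊈T W⊆S → W⊈T (λ i∈ → S⊆T (W⊆S i∈))

  ∪-mono : ∀ {S T : Subset n} {i} → S ⊆ T → S ∪ ⁅ i ⁆ ⊆ T ∪ ⁅ i ⁆
  ∪-mono {S} {T} {i} S⊆T j∈ with x∈p∪q⁻ S ⁅ i ⁆ j∈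
  ... | inj₁ j∈S = x∈p∪q⁺ (inj₁ (S⊆T j∈S))
  ... | inj₂ j∈i = x∈p∪q⁺ {p = T} (inj₂ j∈i)

  -- Points are added greedily; a point once rejected stays rejected, since subsets of free sets are
  -- free.
  maximalFree-above : ∀ {S} → Free F S → ∃[ T ] (S ⊆ T × MaximalFree T)
  maximalFree-above fS =
    let T , S⊆T , fT , max = grow (allFin n) fS in T , S⊆T , fT , λ i → max (∈-allFin i)
    where
    grow : ∀ is {S} → Free F S → ∃[ T ] (S ⊆ T × Free F T × (∀ {i} → i ∈ˡ is → i ∉ T → ¬ Free F (T ∪ ⁅ i ⁆)))
    grow [] {S} fS = S , id , fS , λ ()
    grow (i ∷ is) {S} fS with free? F (S ∪ ⁅ i ⁆)
    ... | yes fSi with T , Si⊆T , fT , max ← grow is fSi =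
      T , (λ j∈ → Si⊆T (x∈p∪q⁺ (inj₁ j∈))) , fT ,
      λ { (here refl) i∉ _ → i∉ (Si⊆T (x∈p∪q⁺ {p = S} (inj₂ (x∈⁅x⁆ i)))) ; (there i∈) → max i∈ }
    ... | no ¬fSi with T , S⊆T , fT , max ← grow is fS =
      T , S⊆T , fT ,
      λ { (here refl) _ fTi → ¬fSi (free-⊆ (∪-mono S⊆T) fTi) ; (there i∈) → max i∈ }

  -- Adding `i` traps some member, hence a minimal one; it must use `i` because `S` alone is free.
  maximalFree-minimal : ∀ {S i} → MaximalFree S → i ∉ S → ∃[ Q ] (Q ∈ˡ minimals × Q ∖ S ≐⁅ i ⁆)
  maximalFree-minimal {S} {i} (fS , max) i∉
    with find (decidable-stable (Any.any? (_⊆? (S ∪ ⁅ i ⁆)) F) λ none → max i i∉ (All.¬Any⇒All¬ F none))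
  ... | W , W∈ , W⊆ with minimal-below W∈
  ... | Q , Q∈ , Q⊆W = Q , Q∈ , i∈Q , i∉ , rest
    where
    rest : ∀ {j} → j ∈ Q → j ≢ i → j ∈ S
    rest j∈ j≢ with x∈p∪q⁻ S ⁅ i ⁆ (W⊆ (Q⊆W j∈))
    ... | inj₁ j∈S = j∈S
    ... | inj₂ j∈i = contradiction (x∈⁅y⁆⇒x≡y i j∈i) j≢
    i∈Q : i ∈ Q
    i∈Q = decidable-stable (i ∈? Q) λ i∉Q →
      All.lookup fS (∈F Q∈) λ j∈ → rest j∈ λ { refl → i∉Q j∈ }

  maximalFree-cosize : ∀ {S} → MaximalFree S → Bounded 1 (_∉ S) N
  maximalFree-cosize {S} mS = bounded-via {k = 1} (λ i Q → Q ∖ S ≐⁅ i ⁆)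
    (λ i∉ → let Q , Q∈ , d = maximalFree-minimal mS i∉ in Q , ∈F Q∈ , d)
    (λ (i∈ , i∉ , _) d → ∖-unique d i∈ i∉)
    (bounded-∈ F)

  abstract

    -- A maximal free set is an intersection of two members of F, so there may be N² of them;
    -- fixing one below each X leaves N, and these still expose every element of every minimal set.
    select : Subset n → Subset n
    select X with anySubset? (λ S → maximalFree? S ×-dec (S ⊆? X))
    ... | yes (S , _) = S
    ... | no _ = X

    select-spec : ∀ {S X} → MaximalFree S → S ⊆ X → MaximalFree (select X) × select X ⊆ X
    select-spec {S} {X} mS S⊆X with anySubset? (λ S → maximalFree? S ×-dec (S ⊆? X))
    ... | yes (_ , p) = p
    ... | no none = ⊥-elim (none (S , mS , S⊆X))

  InMinimal : Fin n → Set
  InMinimal i = ∃[ Q ] (Q ∈ˡ minimals × i ∈ Q)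

  abstract

    -- Extend `Q` without `i` to a maximal free set; it misses `i`, so it escapes into some `X`
    -- missing `i`. Then `select X` misses `i` as well, and its maximality supplies a minimal set,
    -- possibly different from the given `Q`.
    witness : ∀ {i} → InMinimal i →
      ∃[ X ] ∃[ Q ] (X ∈ˡ F × MaximalFree (select X) × Q ∈ˡ minimals × Q ∖ select X ≐⁅ i ⁆)
    witness {i} (Q , Q∈ , i∈Q) =
      let S , Q-i⊆S , mS = maximalFree-above (remove-free Q∈ i∈Q)
          X , X∈ , S⊆X , _ , i∉X , _ = escape-at (proj₁ mS) (∈F Q∈) (∖-S Q-i⊆S (proj₁ mS))
          sS , sX⊆X = select-spec mS S⊆X
          P , P∈ , d = maximalFree-minimal sS (λ i∈ → i∉X (sX⊆X i∈))
      in X , P , X∈ , sS , P∈ , d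
      where
      ∖-S : ∀ {S} → remove i Q ⊆ S → Free F S → Q ∖ S ≐⁅ i ⁆
      ∖-S {S} Q-i⊆S fS = i∈Q , (λ i∈S → All.lookup fS (∈F Q∈) (λ {j} j∈ → in-S i∈S j∈ (j ≟ᶠ i))) , rest
        where
        rest : ∀ {j} → j ∈ Q → j ≢ i → j ∈ S
        rest j∈ j≢ = Q-i⊆S (∈-remove⁺ Q (j∈ , j≢))
        in-S : ∀ {j} → i ∈ S → j ∈ Q → Dec (j ≡ i) → j ∈ S
        in-S i∈S j∈ (yes refl) = i∈S
        in-S i∈S j∈ (no j≢) = rest j∈ j≢

  -- Bounding the union of the minimal members by degrees.

  module _ (K : ℕ) where

    LowDegree : Fin n → Set
    LowDegree i = Bounded 1 (λ Q → Q ∈ˡ minimals × i ∈ Q) K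

    Near : Subset n → Fin n → Set
    Near S i = ∃[ X ] (X ∈ˡ F × Bounded 1 (λ j → j ∈ S × j ∉ X) K × i ∈ S × i ∉ X)

    -- Add `i` to `S` and delete one point from each minimal set through `i`: `i′` from `Q`, a point
    -- outside `Q` from the others. The result is free and misses only `i′` from `Q`, so it escapes
    -- into an `X` missing `i′`.
    swap : ∀ {S Q i i′} → Free F S → Q ∈ˡ minimals → Q ∖ S ≐⁅ i ⁆ → LowDegree i →
      i′ ∈ Q → i′ ∈ S → Near S i′
    swap {S} {Q} {i} {i′} fS Q∈ (i∈Q , i∉S , rest) low i′∈Q i′∈S =
      let X , X∈ , S′⊆X , _ , i′∉X , _ = escape-at S′-free (∈F Q∈) S′-∖ in
      -- Points of `S` outside `X` are picked points, one for each minimal set through `i`. The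
      -- point `i′` is already among them, as the pick of `Q`, so the bound is `K` and not `K` plus
      -- one.
      X , X∈ , bounded-via {k = 1} (λ j P → j ≡ pick P)
          (λ (j∈S , j∉X) → lost j∈S (λ j∈ → j∉X (S′⊆X j∈))) (λ { refl refl → refl }) low , i′∈S , i′∉X
      where
      -- The default value i′ is taken exactly when P ⊆ Q, i.e. for minimal P only when P = Q.
      pick : Subset n → Fin n
      pick P with any? (λ j → (j ∈? P) ×-dec ¬? (j ∈? Q))
      ... | yes (j , _) = j
      ... | no _ = i′
      pick-∈ : ∀ {P} → P ∈ˡ minimals → pick P ∈ P
      pick-∈ {P} P∈ with any? (λ j → (j ∈? P) ×-dec ¬? (j ∈? Q))
      ... | yes (_ , j∈P , _) = j∈P
      ... | no none = All.lookup (minimal Q∈) (∈F P∈)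
        (λ {j} j∈P → decidable-stable (j ∈? Q) λ j∉Q → none (j , j∈P , j∉Q)) i′∈Q
      -- Deletions therefore touch `Q` at `i′` alone.
      pick-∩Q : ∀ P → pick P ∈ Q → pick P ≡ i′
      pick-∩Q P with any? (λ j → (j ∈? P) ×-dec ¬? (j ∈? Q))
      ... | yes (_ , _ , j∉Q) = λ j∈Q → contradiction j∈Q j∉Q
      ... | no _ = λ _ → refl
      Picked : Fin n → Set
      Picked j = Any (λ P → i ∈ P × j ≡ pick P) minimals
      picked? : Decidable Picked
      picked? j = Any.any? (λ P → (i ∈? P) ×-dec (j ≟ᶠ pick P)) minimals
      S′? : Decidable (λ j → (j ∈ S ⊎ j ≡ i) × ¬ Picked j)
      S′? j = ((j ∈? S) ⊎-dec (j ≟ᶠ i)) ×-dec ¬? (picked? j)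
      S′ : Subset n
      S′ = comprehension S′?
      S′-free : Free F S′
      -- A minimal set through `i` has lost its picked point; one avoiding `i` would already lie in
      -- `S`.
      S′-free = free λ {P} P∈ P⊆S′ → case-i P∈ P⊆S′ (i ∈? P)
        where
        case-i : ∀ {P} → P ∈ˡ minimals → P ⊆ S′ → ¬ Dec (i ∈ P)
        case-i P∈ P⊆S′ (yes i∈P) = proj₂ (∈-comprehension⁻ S′? (P⊆S′ (pick-∈ P∈))) (lose P∈ (i∈P , refl))
        case-i P∈ P⊆S′ (no i∉P) = All.lookup fS (∈F P∈) λ j∈ →
          [ id , (λ { refl → contradiction j∈ i∉P }) ]′ (proj₁ (∈-comprehension⁻ S′? (P⊆S′ j∈)))
      S′-∖ : Q ∖ S′ ≐⁅ i′ ⁆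
      S′-∖ = i′∈Q ,
        (λ i′∈ → proj₂ (∈-comprehension⁻ S′? i′∈) (lose Q∈ (i∈Q , sym (pick-∩Q Q (pick-∈ Q∈))))) ,
        λ {j} j∈Q j≢i′ → ∈-comprehension⁺ S′? (
          (case-≟ j∈Q (j ≟ᶠ i)) ,
          λ p → let P , _ , _ , e = find p in j≢i′ (trans e (pick-∩Q P (subst (_∈ Q) e j∈Q))))
        where
        case-≟ : ∀ {j} → j ∈ Q → Dec (j ≡ i) → j ∈ S ⊎ j ≡ i
        case-≟ _ (yes e) = inj₂ e
        case-≟ j∈Q (no j≢i) = inj₁ (rest j∈Q j≢i)
      lost : ∀ {j} → j ∈ S → j ∉ S′ → ∃[ P ] ((P ∈ˡ minimals × i ∈ P) × j ≡ pick P)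
      lost {j} j∈S j∉S′ =
        let P , P∈ , i∈P , e = find (decidable-stable (picked? j) λ ¬p → j∉S′ (∈-comprehension⁺ S′? (inj₁ j∈S , ¬p)))
        in P , (P∈ , i∈P) , e

    Reach : Subset n → Fin n → Set
    Reach S j = j ∉ S ⊎ Near S j

    -- At most `N` points lie outside `S`, and each member `X` adds at most `K`, a bound that `Near`
    -- carries along.
    reach-size : ∀ {S} → MaximalFree S → Bounded 1 (Reach S) (N + N * K)
    reach-size mS = bounded-⊎ {k = 1} (maximalFree-cosize mS)
      (bounded-⋃ {k = 1} F λ _ → bounded-by-member {k = 1} λ (b , _) → bounded-⇒ {k = 1} proj₂ b)

    ⊆-reach : ∀ {S Q i} → MaximalFree S → Q ∈ˡ minimals → Q ∖ S ≐⁅ i ⁆ → LowDegree i →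
      ∀ {j} → j ∈ Q → Reach S j
    ⊆-reach {S} (fS , _) Q∈ d low {j} j∈Q with j ∈? S
    ... | yes j∈S = inj₂ (swap fS Q∈ d low j∈Q j∈S)
    ... | no j∉S = inj₁ j∉S

    -- There are at most `N` minimal sets of at most `N` points each, so at most `N * N` incidences.
    high-bound : Bounded (suc K) (λ i → suc K ≤ℕ length (filter (i ∈?_) minimals)) (N * N)
    high-bound = double-count (suc K) (λ i Q → Q ∈ˡ minimals × i ∈ Q)
      (λ {i} le → filter (i ∈?_) minimals , Unique.filter⁺ (i ∈?_) (Unique.filter⁺ (minimal? F) uF) ,
        All.tabulate (∈-filter⁻ (i ∈?_)) , le)
      (bounded-via {k = 1} (λ (i , Q) (Q′ , i′) → i ≡ i′ × Q ≡ Q′)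
        (λ {(i , Q)} (_ , Q∈ , i∈) → (Q , i) , (∈F Q∈ , Q∈ , i∈) , refl , refl)
        (λ { (refl , refl) (refl , refl) → refl })
        (bounded-Σ F λ _ → bounded-by-member {k = 1} λ (Q∈ , _) → bounded-⇒ {k = 1} proj₂ (minimal-size Q∈)))

    -- Pairs of labels with the same chosen `Q` are coded by the `X` of the first and the second
    -- label itself, which lies in `Reach (select X)`; then collisions are counted. Working with
    -- positions in `L` fixes one witness per label.
    low-bound : ∀ t → Bounded t (λ i → InMinimal i × LowDegree i) (t * (N * t) + N * (N + N * K))
    low-bound t {L} uL pL = subst (λ e → t * e ≤ℕ _) (length-tabulate id)
      (bounded-collisions _≟ˢ_ Qᵢ F (Unique.allFin⁺ (length L)) (All.tabulate λ {a} _ → ∈F (Q∈ a))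
        (bounded-via {k = 1}
          (λ (a , b) (X , j) → X ≡ Xᵢ a × j ≡ label b × Qᵢ a ≡ Qᵢ b)
          (λ {(a , b)} (_ , _ , e) → (Xᵢ a , label b) ,
            (X∈ a , mS a , ⊆-reach (mS a) (Q∈ a) (d a) (proj₂ (prop a)) (subst (label b ∈_) (sym e) (proj₁ (d b)))) ,
            refl , refl , e)
          injective
          (bounded-Σ {P = λ X j → MaximalFree (select X) × Reach (select X) j} F λ _ →
            bounded-by-member {k = 1} λ (mS , _) → bounded-⇒ {k = 1} proj₂ (reach-size mS)))
        t)
      where
      label : Fin (length L) → Fin n
      label = lookup L
      prop : ∀ a → InMinimal (label a) × LowDegree (label a)
      prop a = All.lookup pL (∈-lookup a)
      Xᵢ Qᵢ : Fin (length L) → Subset n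
      Xᵢ a = proj₁ (witness (proj₁ (prop a)))
      Qᵢ a = proj₁ (proj₂ (witness (proj₁ (prop a))))
      X∈ : ∀ a → Xᵢ a ∈ˡ F
      X∈ a = proj₁ (proj₂ (proj₂ (witness (proj₁ (prop a)))))
      mS : ∀ a → MaximalFree (select (Xᵢ a))
      mS a = proj₁ (proj₂ (proj₂ (proj₂ (witness (proj₁ (prop a))))))
      Q∈ : ∀ a → Qᵢ a ∈ˡ minimals
      Q∈ a = proj₁ (proj₂ (proj₂ (proj₂ (proj₂ (witness (proj₁ (prop a)))))))
      d : ∀ a → Qᵢ a ∖ select (Xᵢ a) ≐⁅ label a ⁆
      d a = proj₂ (proj₂ (proj₂ (proj₂ (proj₂ (witness (proj₁ (prop a)))))))
      -- The code gives back the second label, hence the common `Q`; the first label is the only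
      -- point of `Q` outside `select X`.
      injective : ∀ {p p′ : Fin (length L) × Fin (length L)} {y : Subset n × Fin n} →
        proj₁ y ≡ Xᵢ (proj₁ p) × proj₂ y ≡ label (proj₂ p) × Qᵢ (proj₁ p) ≡ Qᵢ (proj₂ p) →
        proj₁ y ≡ Xᵢ (proj₁ p′) × proj₂ y ≡ label (proj₂ p′) × Qᵢ (proj₁ p′) ≡ Qᵢ (proj₂ p′) → p ≡ p′
      injective {a , b} {a′ , b′} (x , j , e) (x′ , j′ , e′)
        with refl ← lookup-injective uL (trans (sym j) j′) =
        cong (_, b) (lookup-injective uL
          (∖-unique (d a′) (subst (label a ∈_) (trans e (sym e′)) (proj₁ (d a)))
            (subst (λ X → label a ∉ select X) (trans (sym x) x′) (proj₁ (proj₂ (d a))))))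

    -- Splitting by degree at `K` leaves about `2 * N * N / k` points, up to a term linear in `N`.
    inMinimal-bound : let k = suc K in Bounded k InMinimal (N * N + (k * (N * (k * k)) + N * N))
    inMinimal-bound = bounded-⇒ {k = suc K} split (bounded-⊎ {k = suc K} high-bound low)
      where
      k = suc K
      split : ∀ {i} → InMinimal i →
        (suc K ≤ℕ length (filter (i ∈?_) minimals)) ⊎ (InMinimal i × LowDegree i)
      split {i} p with length (filter (i ∈?_) minimals) ≤ℕ? K
      ... | no ≰ = inj₁ (≰⇒> ≰)
      ... | yes ≤ = inj₂ (p , λ uM pM → ≤-trans
        (bounded-∈ (filter (i ∈?_) minimals) uM (All.map (λ (Q∈ , i∈) → ∈-filter⁺ (i ∈?_) Q∈ i∈) pM)) ≤)
      low : Bounded k (λ i → InMinimal i × LowDegree i) (k * (N * (k * k)) + N * N)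
      -- The threshold `t = k * k` makes a factor `k` cancel, because `N + N * K` equals `N * k`.
      low {L} uL pL = *-cancelˡ-≤ k (≤-trans (≤-reflexive (sym (*-assoc k k (length L))))
        (≤-trans (low-bound (k * k) uL pL) (≤-reflexive eq)))
        where
        eq : k * k * (N * (k * k)) + N * (N + N * K) ≡ k * (k * (N * (k * k)) + N * N)
        eq = trans (cong (λ m → k * k * (N * (k * k)) + N * m) (sym (*-suc N K))) (factor N k)
          where
          factor : ∀ N k → k * k * (N * (k * k)) + N * (N * k) ≡ k * (k * (N * (k * k)) + N * N)
          factor = solve-∀

-- Edge directions of a family.

-- Some edge of the cube in direction `i` has both ends in `F`.
Edge : ∀ {n} → List (Subset n) → Fin n → Set
Edge F i = ∃[ A ] ∃[ B ] (A ∈ˡ F × B ∈ˡ F × i ∉ A × i ∈ B × remove i A ≡ remove i B)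

remove-comm : ∀ {n} i j (A : Subset n) → remove i (remove j A) ⊆ remove j (remove i A)
remove-comm i j A x∈ =
  let x∈′ , x≢i = ∈-remove⁻ (remove j A) x∈
      x∈A , x≢j = ∈-remove⁻ A x∈′
  in ∈-remove⁺ (remove i A) (∈-remove⁺ A (x∈A , x≢i) , x≢j)

-- Projecting out one direction merges two members, while edges in all other directions survive.
edge-bound : ∀ {n} (F : List (Subset n)) → Bounded 1 (Edge F) (length F)
edge-bound F {L} uL pL = ≤-trans (≤-reflexive (*-identityˡ (length L))) (go F uL pL)
  where
  delete : ∀ {A : Set} {x : A} {xs} → x ∈ˡ xs →
    ∃[ ys ] (suc (length ys) ≡ length xs × (∀ {y} → y ∈ˡ xs → y ≢ x → y ∈ˡ ys))
  delete {xs = x ∷ xs} (here refl) = xs , refl ,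
    λ { (here refl) y≢ → contradiction refl y≢ ; (there y∈) _ → y∈ }
  delete {xs = z ∷ xs} (there x∈) = let ys , e , h = delete x∈ in z ∷ ys , cong suc e ,
    λ { (here refl) _ → here refl ; (there y∈) y≢ → there (h y∈ y≢) }
  go : ∀ {n} (F : List (Subset n)) {L} → Unique L → All (Edge F) L → length L ≤ℕ length F
  go F [] [] = z≤n
  go {n} F (i≢ ∷ uL) ((A , B , A∈ , B∈ , i∉A , i∈B , A≈B) ∷ pL) with delete B∈
  ... | F₁ , e , keep = subst (_ ≤ℕ_) e (s≤s (subst (_ ≤ℕ_) (length-map (remove _) F₁)
      (go (map (remove _) F₁) uL (All.zipWith shrink (i≢ , pL)))))
    where
    -- Dropping `B` loses no projected set, since `A` has the same projection.
    project : ∀ {C} → C ∈ˡ F → remove _ C ∈ˡ map (remove _) F₁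
    project {C} C∈ with C ≟ˢ B
    ... | yes refl = subst (_∈ˡ _) A≈B (∈-map⁺ (remove _) (keep A∈ λ { refl → i∉A i∈B }))
    ... | no C≢B = ∈-map⁺ (remove _) (keep C∈ C≢B)
    shrink : ∀ {j} → (_ ≢ j × Edge F j) → Edge (map (remove _) F₁) j
    shrink (i≢j , C , D , C∈ , D∈ , j∉C , j∈D , C≈D) =
      _ , _ , project C∈ , project D∈ , (λ j∈ → j∉C (proj₁ (∈-remove⁻ C j∈))) ,
      ∈-remove⁺ D (j∈D , λ { refl → i≢j refl }) ,
      trans (⊆-antisym (remove-comm _ _ C) (remove-comm _ _ C))
        (trans (cong (remove _) C≈D) (⊆-antisym (remove-comm _ _ D) (remove-comm _ _ D)))

-- Diamonds and the consequences of saturation.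

⊈⇒∃ : ∀ {n} {P Q : Subset n} → P ⊈ Q → ∃[ i ] (i ∈ P × i ∉ Q)
⊈⇒∃ {P = P} {Q} P⊈Q = decidable-stable (any? (λ i → (i ∈? P) ×-dec ¬? (i ∈? Q))) λ none →
  P⊈Q λ {i} i∈P → decidable-stable (i ∈? Q) λ i∉Q → none (i , i∈P , i∉Q)

-- Plain inclusions capture diamonds here: incomparable middle sets force the four sets to be
-- distinct and the inclusions proper.
DiamondFree : ∀ {n} → Family n → Set
DiamondFree F = ∀ {W X Y Z} → W ∈ˡ F → X ∈ˡ F → Y ∈ˡ F → Z ∈ˡ F →
  W ⊆ X → W ⊆ Y → X ⊆ Z → Y ⊆ Z → X ⊈ Y → ¬ (Y ⊈ X)

-- The roles a new set can play in the diamond it creates, with the two middle roles merged by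
-- symmetry. `middle` records a point of `S` outside `W`, which `generic-edge` uses.
data Position {n} (F : Family n) (S : Subset n) : Set where
  bottom : ∀ {X Y Z} → X ∈ˡ F → Y ∈ˡ F → Z ∈ˡ F →
    S ⊆ X → S ⊆ Y → X ⊆ Z → Y ⊆ Z → X ⊈ Y → Y ⊈ X → Position F S
  middle : ∀ {W Y Z} → W ∈ˡ F → Y ∈ˡ F → Z ∈ˡ F →
    W ⊂ S → W ⊆ Y → S ⊆ Z → Y ⊆ Z → S ⊈ Y → Y ⊈ S → Position F S
  top : ∀ {W X Y} → W ∈ˡ F → X ∈ˡ F → Y ∈ˡ F →
    W ⊆ X → W ⊆ Y → X ⊆ S → Y ⊆ S → X ⊈ Y → Y ⊈ X → Position F S

diamondFree : ∀ {n} {F : Family n} → D2Saturated F → DiamondFree F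
diamondFree (none , _) {W} {X} {Y} {Z} W∈ X∈ Y∈ Z∈ W⊆X W⊆Y X⊆Z Y⊆Z X⊈Y Y⊈X =
  none (W , X , Y , Z , W∈ , X∈ , Y∈ , Z∈ ,
    (λ { refl → X⊈Y W⊆Y }) , (λ { refl → Y⊈X W⊆X }) , (λ { refl → X⊈Y λ i∈ → W⊆Y (X⊆Z i∈) }) ,
    (λ { refl → X⊈Y id }) , (λ { refl → Y⊈X Y⊆Z }) , (λ { refl → X⊈Y X⊆Z }) ,
    (W⊆X , ⊈⇒∃ (λ X⊆W → X⊈Y λ i∈ → W⊆Y (X⊆W i∈))) , (X⊆Z , ⊈⇒∃ (λ Z⊆X → Y⊈X λ i∈ → Z⊆X (Y⊆Z i∈))) ,
    (W⊆Y , ⊈⇒∃ (λ Y⊆W → Y⊈X λ i∈ → W⊆X (Y⊆W i∈))) , (Y⊆Z , ⊈⇒∃ (λ Z⊆Y → X⊈Y λ i∈ → Z⊆Y (X⊆Z i∈))) ,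
    (λ X⊆Y → X⊈Y X⊆Y) , (λ Y⊆X → Y⊈X Y⊆X))

position : ∀ {n} {F : Family n} → D2Saturated F → ∀ S → ¬ S ∈ˡ F → Position F S
position {F = F} (none , sat) S S∉ with sat S S∉
... | W , X , Y , Z , w , x , y , z , W≢X , W≢Y , W≢Z , X≢Y , X≢Z , Y≢Z ,
      W⊂X , X⊂Z , W⊂Y , Y⊂Z , X⊈Y , Y⊈X = locate w x y z
  where
  tail : ∀ {V} → V ∈ˡ S ∷ F → V ≢ S → V ∈ˡ F
  tail (here refl) V≢S = contradiction refl V≢S
  tail (there V∈) _ = V∈
  locate : W ∈ˡ S ∷ F → X ∈ˡ S ∷ F → Y ∈ˡ S ∷ F → Z ∈ˡ S ∷ F → Position F S
  locate (here refl) x y z = bottom (tail x (≢-sym W≢X)) (tail y (≢-sym W≢Y)) (tail z (≢-sym W≢Z))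
    (proj₁ W⊂X) (proj₁ W⊂Y) (proj₁ X⊂Z) (proj₁ Y⊂Z) X⊈Y Y⊈X
  locate (there w) (here refl) y z = middle w (tail y (≢-sym X≢Y)) (tail z (≢-sym X≢Z))
    W⊂X (proj₁ W⊂Y) (proj₁ X⊂Z) (proj₁ Y⊂Z) X⊈Y Y⊈X
  locate (there w) (there x) (here refl) z = middle w x (tail z (≢-sym Y≢Z))
    W⊂Y (proj₁ W⊂X) (proj₁ Y⊂Z) (proj₁ X⊂Z) Y⊈X X⊈Y
  locate (there w) (there x) (there y) (here refl) = top w x y
    (proj₁ W⊂X) (proj₁ W⊂Y) (proj₁ X⊂Z) (proj₁ Y⊂Z) X⊈Y Y⊈X
  locate (there w) (there x) (there y) (there z) = ⊥-elim (none
    (W , X , Y , Z , w , x , y , z , W≢X , W≢Y , W≢Z , X≢Y , X≢Z , Y≢Z ,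
      W⊂X , X⊂Z , W⊂Y , Y⊂Z , X⊈Y , Y⊈X))

co-free : ∀ {n} {F : Family n} {S} → Free (map ∁ F) S → ∀ {V} → V ∈ˡ F → ∁ S ⊈ V
co-free fS V∈ ∁S⊆V = All.lookup fS (∈-map⁺ ∁ V∈) λ i∈ →
  x∉∁p⇒x∈p λ i∈∁S → x∈∁p⇒x∉p i∈ (∁S⊆V i∈∁S)

module _ {n : ℕ} {F : Family n} (saturated : D2Saturated F) where

  -- A free set can only be a bottom. If `Q` lay below both middle sets, it could replace `S` as a
  -- bottom inside `F`.
  escapes : Escape F
  escapes {S} {Q} fS Q∈ with position saturated S (λ S∈ → All.lookup fS S∈ id)
  ... | middle W∈ _ _ W⊂S _ _ _ _ _ = ⊥-elim (All.lookup fS W∈ (proj₁ W⊂S))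
  ... | top W∈ _ _ W⊆X _ X⊆S _ _ _ = ⊥-elim (All.lookup fS W∈ (λ i∈ → X⊆S (W⊆X i∈)))
  ... | bottom {X} {Y} X∈ Y∈ Z∈ S⊆X S⊆Y X⊆Z Y⊆Z X⊈Y Y⊈X with Q ⊆? X
  ... | no Q⊈X = X , X∈ , S⊆X , ⊈⇒∃ Q⊈X
  ... | yes Q⊆X = Y , Y∈ , S⊆Y , ⊈⇒∃ λ Q⊆Y →
    diamondFree saturated Q∈ X∈ Y∈ Z∈ Q⊆X Q⊆Y X⊆Z Y⊆Z X⊈Y Y⊈X

  -- Dual argument: `∁ S` lies in no member, so it is a top, and a `Q` above both middle sets could
  -- replace it.
  co-escapes : Escape (map ∁ F)
  co-escapes {S} fS Q∈ with ∈-map⁻ ∁ Q∈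
  ... | Q , Q∈F , refl with position saturated (∁ S) (λ S∈ → co-free fS S∈ id)
  ... | bottom X∈ _ _ S⊆X _ _ _ _ _ = ⊥-elim (co-free fS X∈ S⊆X)
  ... | middle _ _ Z∈ _ _ S⊆Z _ _ _ = ⊥-elim (co-free fS Z∈ S⊆Z)
  ... | top {W} {X} {Y} W∈ X∈ Y∈ W⊆X W⊆Y X⊆S Y⊆S X⊈Y Y⊈X with X ⊆? Q
  ... | no X⊈Q = let i , i∈X , i∉Q = ⊈⇒∃ X⊈Q in
      ∁ X , ∈-map⁺ ∁ X∈ , (λ j∈S → x∉p⇒x∈∁p λ j∈X → x∈∁p⇒x∉p (X⊆S j∈X) j∈S) ,
      i , x∉p⇒x∈∁p i∉Q , x∈p⇒x∉∁p i∈X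
  ... | yes X⊆Q =
      let i , i∈Y , i∉Q = ⊈⇒∃ λ Y⊆Q → diamondFree saturated W∈ X∈ Y∈ Q∈F W⊆X W⊆Y X⊆Q Y⊆Q X⊈Y Y⊈X in
      ∁ Y , ∈-map⁺ ∁ Y∈ , (λ j∈S → x∉p⇒x∈∁p λ j∈Y → x∈∁p⇒x∉p (Y⊆S j∈Y) j∈S) ,
      i , x∉p⇒x∈∁p i∉Q , x∈p⇒x∉∁p i∈Y

  member : ∃[ V ] V ∈ˡ F
  member with Any.any? (∅ ≟ˢ_) F
  ... | yes ∅∈ = ∅ , ∅∈
  ... | no ∅∉ with position saturated ∅ ∅∉
  ... | bottom X∈ _ _ _ _ _ _ _ _ = _ , X∈
  ... | middle W∈ _ _ _ _ _ _ _ _ = _ , W∈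
  ... | top W∈ _ _ _ _ _ _ _ _ = _ , W∈

  -- Let `P` be maximal among the members avoiding `i`. If `P` with `i` added were not in `F`, each
  -- role it could play would yield a diamond inside `F`.
  generic-edge : ∀ {i} →
    (∀ {W} → W ∈ˡ F → ∃[ Q ] (Q ∈ˡ F × Q ⊆ W × i ∉ Q)) →
    (∀ {W} → W ∈ˡ F → ∃[ Z ] (Z ∈ˡ F × W ⊆ Z × i ∈ Z)) → Edge F i
  generic-edge {i} below above = edge
    where
    avoid? = λ V → ¬? (i ∈? V)
    start = below (proj₂ member)
    greatest = maximal-above {_≼_ = _⊆_} id (λ p q i∈ → q (p i∈)) _⊆?_ (filter avoid? F)
      (∈-filter⁺ avoid? (proj₁ (proj₂ start)) (proj₂ (proj₂ (proj₂ start))))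
    P = proj₁ greatest
    P∈ : P ∈ˡ F
    P∈ = proj₁ (∈-filter⁻ avoid? (proj₁ (proj₂ greatest)))
    i∉P : i ∉ P
    i∉P = proj₂ (∈-filter⁻ avoid? {xs = F} (proj₁ (proj₂ greatest)))
    P-max : ∀ {V} → V ∈ˡ F → i ∉ V → P ⊆ V → V ⊆ P
    P-max V∈ i∉V P⊆V = proj₂ (proj₂ (proj₂ greatest)) (∈-filter⁺ avoid? V∈ i∉V) P⊆V
    P⁺ = P ∪ ⁅ i ⁆
    P⊆P⁺ : P ⊆ P⁺
    P⊆P⁺ j∈ = x∈p∪q⁺ (inj₁ j∈)
    i∈P⁺ : i ∈ P⁺
    i∈P⁺ = x∈p∪q⁺ {p = P} (inj₂ (x∈⁅x⁆ i))
    P⁺⊆ : ∀ {V} → P ⊆ V → i ∈ V → P⁺ ⊆ V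
    P⁺⊆ P⊆V i∈V j∈ with x∈p∪q⁻ P ⁅ i ⁆ j∈
    ... | inj₁ j∈P = P⊆V j∈P
    ... | inj₂ j∈i with refl ← x∈⁅y⁆⇒x≡y i j∈i = i∈V
    ⊆P : ∀ {V} → V ⊆ P⁺ → i ∉ V → V ⊆ P
    ⊆P V⊆ i∉V j∈ with x∈p∪q⁻ P ⁅ i ⁆ (V⊆ j∈)
    ... | inj₁ j∈P = j∈P
    ... | inj₂ j∈i with refl ← x∈⁅y⁆⇒x≡y i j∈i = contradiction j∈ i∉V
    df = diamondFree saturated
    -- A `Y` above `P` contains `P⁺` if it has `i`, and lies inside `P` by maximality otherwise.
    incomparable : ∀ {Y} → Y ∈ˡ F → P⁺ ⊈ Y → Y ⊈ P⁺ → P ⊈ Y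
    incomparable {Y} Y∈ P⁺⊈Y Y⊈P⁺ P⊆Y with i ∈? Y
    ... | yes i∈Y = P⁺⊈Y (P⁺⊆ P⊆Y i∈Y)
    ... | no i∉Y = Y⊈P⁺ (λ j∈ → P⊆P⁺ (P-max Y∈ i∉Y P⊆Y j∈))
    not-position : ¬ Position F P⁺
    not-position (bottom X∈ Y∈ Z∈ S⊆X S⊆Y X⊆Z Y⊆Z X⊈Y Y⊈X) =
      df P∈ X∈ Y∈ Z∈ (λ j∈ → S⊆X (P⊆P⁺ j∈)) (λ j∈ → S⊆Y (P⊆P⁺ j∈)) X⊆Z Y⊆Z X⊈Y Y⊈X
    -- A member above `P` containing `i` takes over as top; for a bottom, `P` itself does.
    not-position (top W∈ X∈ Y∈ W⊆X W⊆Y X⊆S Y⊆S X⊈Y Y⊈X) =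
      let Z , Z∈ , P⊆Z , i∈Z = above P∈ in
      df W∈ X∈ Y∈ Z∈ W⊆X W⊆Y (λ j∈ → P⁺⊆ P⊆Z i∈Z (X⊆S j∈)) (λ j∈ → P⁺⊆ P⊆Z i∈Z (Y⊆S j∈)) X⊈Y Y⊈X
    not-position (middle {W} {Y} W∈ Y∈ Z∈ (W⊆S , x , x∈S , x∉W) W⊆Y S⊆Z Y⊆Z S⊈Y Y⊈S) with i ∈? W
    -- Here `W` lies in `P`, so `P` replaces `P⁺` as a middle set.
    ... | no i∉W = df W∈ P∈ Y∈ Z∈ (⊆P W⊆S i∉W) W⊆Y (λ j∈ → S⊆Z (P⊆P⁺ j∈)) Y⊆Z
          (incomparable Y∈ S⊈Y Y⊈S) (λ Y⊆P → Y⊈S λ j∈ → P⊆P⁺ (Y⊆P j∈))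
    -- A different diamond: `W` and `P` in the middle, above a member of `W` avoiding `i`. They are
    -- incomparable since `i` is not in `P` and `x` is not in `W`.
    ... | yes i∈W = let Q , Q∈ , Q⊆W , i∉Q = below W∈ in
      df Q∈ W∈ P∈ Z∈ Q⊆W (⊆P (λ j∈ → W⊆S (Q⊆W j∈)) i∉Q) (λ j∈ → Y⊆Z (W⊆Y j∈)) (λ j∈ → S⊆Z (P⊆P⁺ j∈))
        (λ W⊆P → i∉P (W⊆P i∈W)) (λ P⊆W → x∉W (P⁺⊆ P⊆W i∈W x∈S))
    edge : Edge F i
    edge with Any.any? (P⁺ ≟ˢ_) F
    ... | no P⁺∉ = ⊥-elim (not-position (position saturated P⁺ P⁺∉))
    ... | yes P⁺∈ = P , P⁺ , P∈ , P⁺∈ , i∉P , i∈P⁺ ,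
      ⊆-antisym (λ j∈ → let j∈P , j≢ = ∈-remove⁻ P j∈ in ∈-remove⁺ P⁺ (P⊆P⁺ j∈P , j≢))
        (λ j∈ → let j∈P⁺ , j≢ = ∈-remove⁻ P⁺ j∈ in ∈-remove⁺ P (without j∈P⁺ j≢ , j≢))
      where
      without : ∀ {j} → j ∈ P⁺ → j ≢ i → j ∈ P
      without j∈ j≢ with x∈p∪q⁻ P ⁅ i ⁆ j∈
      ... | inj₁ j∈P = j∈P
      ... | inj₂ j∈i = contradiction (x∈⁅y⁆⇒x≡y i j∈i) j≢

-- Bounding the ground set.

∁-injective : ∀ {n} {X Y : Subset n} → ∁ X ≡ ∁ Y → X ≡ Y
∁-injective e = ⊆-antisym (∁p⊆∁q⇒p⊇q (λ j∈ → subst (_ ∈_) (sym e) j∈)) (∁p⊆∁q⇒p⊇q (λ j∈ → subst (_ ∈_) e j∈))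

-- A point lies in a minimal member, is missed by a maximal one, or is an edge direction; the three
-- bounds are added after scaling by `k`.
ground-bound : ∀ {n} {F : Family n} → Unique F → D2Saturated F → ∀ K → let N = length F; k = suc K in
  k * n ≤ℕ 4 * (N * N) + (2 * (k * k * k) + k) * N
ground-bound {n} {F} uF saturated K = subst₂ (λ e m → k * e ≤ℕ m) (length-tabulate id) eq
  (bounded-⊎ {k = k} (Lower.inMinimal-bound F uF (escapes saturated) K)
    (bounded-⊎ {k = k} (Lower.inMinimal-bound (map ∁ F) (Unique.map⁺ ∁-injective uF) (co-escapes saturated) K)
      (bounded-scale k (edge-bound F)))
    (Unique.allFin⁺ n) (All.tabulate λ {i} _ → classify i))
  where
  k = suc K
  N = length F
  module ↓ = Lower F uF (escapes saturated)
  module ↑ = Lower (map ∁ F) (Unique.map⁺ ∁-injective uF) (co-escapes saturated)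
  classify : ∀ i → ↓.InMinimal i ⊎ ↑.InMinimal i ⊎ Edge F i
  classify i with Any.any? (i ∈?_) ↓.minimals | Any.any? (i ∈?_) ↑.minimals
  ... | yes p | _ = inj₁ (find p)
  ... | no _ | yes p = inj₂ (inj₁ (find p))
  ... | no ¬↓ | no ¬↑ = inj₂ (inj₂ (generic-edge saturated below above))
    where
    below : ∀ {W} → W ∈ˡ F → ∃[ Q ] (Q ∈ˡ F × Q ⊆ W × i ∉ Q)
    below W∈ = let Q , Q∈ , Q⊆W = ↓.minimal-below W∈ in Q , ↓.∈F Q∈ , Q⊆W , λ i∈ → ¬↓ (lose Q∈ i∈)
    above : ∀ {W} → W ∈ˡ F → ∃[ Z ] (Z ∈ˡ F × W ⊆ Z × i ∈ Z)
    above W∈ with ↑.minimal-below (∈-map⁺ ∁ W∈)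
    ... | Q , Q∈ , Q⊆∁W with ∈-map⁻ ∁ (↑.∈F Q∈)
    ... | Z , Z∈ , refl = Z , Z∈ , ∁p⊆∁q⇒p⊇q Q⊆∁W , x∉∁p⇒x∈p λ i∈ → ¬↑ (lose Q∈ i∈)
  expand : ∀ N k → N * N + (k * (N * (k * k)) + N * N) + ((N * N + (k * (N * (k * k)) + N * N)) + k * N)
    ≡ 4 * (N * N) + (2 * (k * k * k) + k) * N
  expand = solve-∀
  eq : N * N + (k * (N * (k * k)) + N * N) +
    ((↑.N * ↑.N + (k * (↑.N * (k * k)) + ↑.N * ↑.N)) + k * N) ≡ 4 * (N * N) + (2 * (k * k * k) + k) * N
  eq rewrite length-map ∁ F = expand N k

-- Passage to the square root and to rational constants.

-- The coefficient only has to exceed 4 · 16.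
sqrt-bound : ∀ C N n → 65 * n ≤ℕ 4 * (N * N) + C * N → suc (C * C * 16) ≤ℕ n → 16 * n ≤ℕ N * N
sqrt-bound C N n h large with 16 * n ≤ℕ? N * N
... | yes ok = ok
... | no ≰ = contradiction contra (<-irrefl refl)
  where
  open ≤-Reasoning
  N²≤ : N * N ≤ℕ 16 * n
  N²≤ = <⇒≤ (≰⇒> ≰)
  n≤CN : n ≤ℕ C * N
  -- Of the `65 * n` on the left, `64 * n` absorbs the quadratic term; the one remaining copy of `n`
  -- makes `N` at least linear in `n`.
  n≤CN = +-cancelˡ-≤ (64 * n) n (C * N) (begin
    64 * n + n ≡⟨ +-comm (64 * n) n ⟩
    65 * n ≤⟨ h ⟩
    4 * (N * N) + C * N ≤⟨ +-monoˡ-≤ (C * N) (*-monoʳ-≤ 4 N²≤) ⟩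
    4 * (16 * n) + C * N ≡⟨ cong (_+ C * N) (*-assoc 4 16 n) ⟨
    64 * n + C * N ∎)
  swap-middle : ∀ C N → (C * N) * (C * N) ≡ C * C * (N * N)
  swap-middle = solve-∀
  contra : n * n <ℕ n * n
  contra = begin-strict
    n * n ≤⟨ *-mono-≤ n≤CN n≤CN ⟩
    (C * N) * (C * N) ≡⟨ swap-middle C N ⟩
    C * C * (N * N) ≤⟨ *-monoʳ-≤ (C * C) N²≤ ⟩
    C * C * (16 * n) ≡⟨ *-assoc (C * C) 16 n ⟨
    C * C * 16 * n <⟨ *-monoˡ-< n {{>-nonZero (≤-trans (s≤s z≤n) large)}} large ⟩
    n * n ∎

-- `ℕtoℚ` normalises by a gcd, so order and products are checked on unnormalised fractions; the
-- stored 0 encodes denominator 1.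
toℚᵘ-ℕtoℚ : ∀ m → toℚᵘ (ℕtoℚ m) ≃ᵘ mkℚᵘ (+ m) 0
toℚᵘ-ℕtoℚ m = ℚ.toℚᵘ-fromℚᵘ (mkℚᵘ (+ m) 0)

ℕtoℚ-mono : ∀ {a b} → a ≤ℕ b → ℕtoℚ a ≤ℚ ℕtoℚ b
ℕtoℚ-mono {a} {b} a≤b = ℚ.toℚᵘ-cancel-≤ (ℚᵘ.≤-respˡ-≃ (ℚᵘ.≃-sym (toℚᵘ-ℕtoℚ a))
  (ℚᵘ.≤-respʳ-≃ (ℚᵘ.≃-sym (toℚᵘ-ℕtoℚ b))
    (*≤* (subst₂ ℤ._≤_ (sym (ℤ.*-identityʳ (+ a))) (sym (ℤ.*-identityʳ (+ b))) (ℤ.+≤+ a≤b)))))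

ℕtoℚ-* : ∀ a b → ℕtoℚ a *ℚ ℕtoℚ b ≡ ℕtoℚ (a * b)
ℕtoℚ-* a b = ℚ.toℚᵘ-injective (begin
  toℚᵘ (ℕtoℚ a *ℚ ℕtoℚ b) ≈⟨ ℚ.toℚᵘ-homo-* (ℕtoℚ a) (ℕtoℚ b) ⟩
  toℚᵘ (ℕtoℚ a) *ᵘ toℚᵘ (ℕtoℚ b) ≈⟨ ℚᵘ.*-cong (toℚᵘ-ℕtoℚ a) (toℚᵘ-ℕtoℚ b) ⟩
  mkℚᵘ (+ a) 0 *ᵘ mkℚᵘ (+ b) 0 ≈⟨ *≡* (cong (ℤ._* + 1) (sym (ℤ.pos-* a b))) ⟩
  mkℚᵘ (+ (a * b)) 0 ≈⟨ toℚᵘ-ℕtoℚ (a * b) ⟨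
  toℚᵘ (ℕtoℚ (a * b)) ∎)
  where
  open ≈-Reasoning ℚᵘ.≃-setoid

c*√≤ : ∀ {c} n N → c < ℕtoℚ 4 → 16 * n ≤ℕ N * N → c *√ n ≤ N
c*√≤ {c} n N c<4 16n≤ with ℚ.≤-total c 0ℚ
... | inj₁ c≤0 = inj₁ c≤0
... | inj₂ 0≤c = inj₂ (0≤c , (begin
  c *ℚ c *ℚ ℕtoℚ n ≤⟨ ℚ.*-monoʳ-≤-nonNeg (ℕtoℚ n) {{nonNegative (ℕtoℚ-mono {0} {n} z≤n)}} c²≤ ⟩
  ℕtoℚ 16 *ℚ ℕtoℚ n ≡⟨ ℕtoℚ-* 16 n ⟩
  ℕtoℚ (16 * n) ≤⟨ ℕtoℚ-mono 16n≤ ⟩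
  ℕtoℚ (N * N) ∎))
  where
  open ℚ.≤-Reasoning
  c²≤ : c *ℚ c ≤ℚ ℕtoℚ 16
  c²≤ = ℚ.≤-trans (ℚ.*-monoʳ-≤-nonNeg c {{nonNegative 0≤c}} (ℚ.<⇒≤ c<4))
    (ℚ.*-monoˡ-≤-nonNeg (ℕtoℚ 4) (ℚ.<⇒≤ c<4))

theorem2 : (c : ℚ) → c < ℕtoℚ 4 →
    ∃[ n₀ ] ((n : ℕ) → n₀ ≤ℕ n → (F : Family n) → Unique F →
    D2Saturated F → c *√ n ≤ length F)
-- `K = 64` gives `k = 65`, the least `k` with `4 / k` below `1 / 16`; `C` is the resulting
-- coefficient of `N` in `ground-bound`.
theorem2 c c<4 = suc (C * C * 16) , λ n n₀≤n F uF saturated →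
  c*√≤ n (length F) c<4 (sqrt-bound C (length F) n (ground-bound uF saturated 64) n₀≤n)
  where
  C = 2 * (65 * 65 * 65) + 65
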